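{- Let $G$ be an infinite, locally finite, connected graph with infinite motion, let $v_0\in V(G)$ and let $\varepsilon>0$. If there exist infinitely many $n\in\mathbb{N}$ such that $$|S_{v_0}(n)|\le \frac{n}{(1+\varepsilon)\log_2 n},$$ then the distinguishing number $D(G)$ is either $1$ or $2$.
   Context: $S_{v_0}(n)$ is the set of vertices at distance exactly $n$ from $v_0$. $G$ has infinite motion if every nontrivial automorphism of $G$ moves infinitely many vertices. The distinguishing number $D(G)$ is the least cardinal $d$ such that there is a labeling $V(G)\to X$ with $|X|=d$ preserved by no nontrivial automorphism of $G$. -}

module Defs where

open import Data.Nat using (ℕ; zero; suc; _+_; _*_; _^_; _≤_; _<_)
open import Data.Bool using (Bool)
open import Data.List using (List; length)
open import Data.List.Membership.Propositional using (_∈_; _∉_)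
open import Data.Product using (Σ; ∃; _×_; _,_)
open import Data.Empty using (⊥)
open import Relation.Nullary using (¬_)
open import Relation.Binary.PropositionalEquality using (_≡_; _≢_)
open import Function.Bundles using (_⇔_)

record Graph : Set₁ where
  field
    V     : Set
    E     : V → V → Set
    sym   : ∀ {u w} → E u w → E w u
    irrefl : ∀ {u} → ¬ E u u

module _ (G : Graph) where
  open Graph G

  data Walk : V → V → ℕ → Set where
    here : ∀ {u} → Walk u u zero
    step : ∀ {u v w n} → E u v → Walk v w n → Walk u w (suc n)

  Connected : Set
  Connected = ∀ u w → ∃ λ n → Walk u w n

  LocallyFinite : Set
  LocallyFinite = ∀ v → Σ (List V) λ ns → ∀ w → (E v w ⇔ (w ∈ ns))

  Infinite : Set
  Infinite = ¬ (Σ (List V) λ xs → ∀ v → v ∈ xs)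

  Dist : V → V → ℕ → Set
  Dist u w n = Walk u w n × (∀ m → m < n → ¬ Walk u w m)

  InSphere : V → ℕ → V → Set
  InSphere v0 n w = Dist v0 w n

  record Aut : Set where
    field
      to      : V → V
      from    : V → V
      to-from : ∀ v → to (from v) ≡ v
      from-to : ∀ v → from (to v) ≡ v
      hom     : ∀ u w → (E u w ⇔ E (to u) (to w))

  Nontrivial : Aut → Set
  Nontrivial φ = ∃ λ v → Aut.to φ v ≢ v

  InfiniteMotion : Set
  InfiniteMotion = ∀ φ → Nontrivial φ →
    ∀ (xs : List V) → ∃ λ v → (v ∉ xs) × (Aut.to φ v ≢ v)

  Distinguishing : {X : Set} → (V → X) → Set
  Distinguishing c = ∀ φ → (∀ v → c (Aut.to φ v) ≡ c v) → ∀ v → Aut.to φ v ≡ v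

  -- D(G) ≤ 2, i.e. D(G) ∈ {1,2} (G nonempty): a distinguishing 2-labeling exists.
  DistNumber≤2 : Set
  DistNumber≤2 = Σ (V → Bool) Distinguishing

  -- |S_{v0}(n)| ≤ n / ((1 + p/q) log₂ n), for n ≥ 2, written without reals as
  -- n ^ (|S| * (q + p)) ≤ 2 ^ (n * q), where |S| is bounded via a covering list.
  SmallSphere : V → ℕ → ℕ → ℕ → Set
  SmallSphere v0 p q n =
    2 ≤ n ×
    Σ (List V) λ xs → (∀ w → InSphere v0 n w → w ∈ xs) ×
                      (n ^ (length xs * (q + p)) ≤ 2 ^ (n * q))

{-# OPTIONS --safe #-}

-- Vertices are coloured according to their distance from v0.  On some spheres the
-- colour is prescribed: the first two and, with period P, later ones are black, while
-- the spheres 2, 3, ..., 2P + 1 except 2P are white.  Every colour-preserving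
-- automorphism then maps v0 to itself or to a neighbour with the same closed
-- neighbourhood; in the latter case the transposition of the two would be an
-- automorphism moving two vertices only.  So v0 is fixed and spheres are preserved.
--
-- An automorphism of the ball of radius n that fixes the sphere S(n) pointwise extends
-- by the identity, hence is trivial by infinite motion.  So there are at most s ^ s ball
-- automorphisms with s = |S(n)|, and those moving a vertex of the ball of radius m move
-- a vertex of each sphere S(k), m ≤ k ≤ n.  On each free sphere some colouring breaks
-- half of those still unbroken, and when S(n) is small there are enough free spheres
-- between m and n to break all of them.  Repeating this with m := n handles all of V.

module Submission where

open import Defs
open import Data.Bool using (Bool; true; false; _∨_; if_then_else_)
import Data.Bool.Properties as Bool
open import Data.Empty using (⊥; ⊥-elim)
open import Data.List
  using (List; []; _∷_; length; map; filter; concatMap; upTo; cartesianProduct; cartesianProductWith)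
open import Data.List.Properties using (length-map; length-++; length-filter; ≡-dec)
open import Data.List.Membership.Propositional using (_∈_; _∉_; find; lose)
open import Data.List.Membership.Propositional.Properties
  using (∈-map⁺; ∈-filter⁺; ∈-filter⁻; ∈-concatMap⁺; ∈-concatMap⁻; ∈-upTo⁺; ∈-upTo⁻;
         ∈-cartesianProduct⁺; ∈-cartesianProductWith⁺)
import Data.List.Membership.DecPropositional as DecMembership
open import Data.List.Relation.Unary.Any using (Any; here; there; any?)
open import Data.Maybe using (Maybe; just; nothing; fromMaybe)
open import Data.Nat
open import Data.Nat.Divisibility
open import Data.Nat.DivMod
open import Data.Nat.ListAction using (sum)
open import Data.Nat.Properties
open import Data.Nat.Tactic.RingSolver using (solve-∀)
open import Data.Product using (Σ; ∃; _×_; _,_; proj₁; proj₂)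
open import Data.Sum using (_⊎_; inj₁; inj₂)
open import Function using (_∘_; case_of_)
open import Function.Bundles using (Equivalence; mk⇔)
open import Relation.Binary.Definitions using (DecidableEquality)
open import Relation.Binary.PropositionalEquality
open import Relation.Nullary
open import Relation.Nullary.Decidable
  using (map′; dec-true; dec-false; decidable-stable; _×-dec_; _→-dec_; ¬?)

-- Finite search and enumeration of maps

least : {P : ℕ → Set} → (∀ n → Dec (P n)) → ∀ n → P n →
  ∃ λ k → P k × (∀ j → j < k → ¬ P j)
least P? zero    p = 0 , p , λ _ ()
least P? (suc n) p with P? 0
... | yes p₀ = 0 , p₀ , λ _ ()
... | no ¬p₀ = let k , pₖ , below = least (P? ∘ suc) n p in
  suc k , pₖ , λ { zero _ → ¬p₀ ; (suc j) (s≤s j<k) → below j j<k }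

module FiniteMaps {A : Set} (_≟ᴬ_ : DecidableEquality A) where

  update : {B : Set} → A → B → (A → B) → A → B
  update d y f x = if does (x ≟ᴬ d) then y else f x

  -- Maps are listed only up to their values on `ds`; elsewhere they take the value `y`.
  maps : {B : Set} → B → List A → List B → List (A → B)
  maps y []       ys = (λ _ → y) ∷ []
  maps y (d ∷ ds) ys = cartesianProductWith (update d) ys (maps y ds ys)

  length-product : {B C D : Set} (h : B → C → D) (xs : List B) (ys : List C) →
    length (cartesianProductWith h xs ys) ≡ length xs * length ys
  length-product h []       ys = refl
  length-product h (x ∷ xs) ys =
    trans (length-++ (map (h x) ys)) (cong₂ _+_ (length-map (h x) ys) (length-product h xs ys))

  length-maps : {B : Set} (y : B) → ∀ ds ys → length (maps y ds ys) ≡ length ys ^ length ds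
  length-maps y []       ys = refl
  length-maps y (d ∷ ds) ys =
    trans (length-product (update d) ys (maps y ds ys)) (cong (length ys *_) (length-maps y ds ys))

  maps-complete : {B : Set} (y : B) → ∀ ds ys (f : A → B) → (∀ {d} → d ∈ ds → f d ∈ ys) →
    ∃ λ g → g ∈ maps y ds ys × (∀ {d} → d ∈ ds → g d ≡ f d)
  maps-complete y []       ys f f∈ = (λ _ → y) , here refl , λ ()
  maps-complete y (d ∷ ds) ys f f∈ with maps-complete y ds ys f (f∈ ∘ there)
  ... | g , g∈ , g≡f = update d (f d) g , ∈-cartesianProductWith⁺ (update d) (f∈ (here refl)) g∈ , agree
    where
    agree : ∀ {x} → x ∈ d ∷ ds → update d (f d) g x ≡ f x
    agree {x} x∈ with x ≟ᴬ d | x∈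
    ... | yes refl | _         = refl
    ... | no x≢d   | here x≡d  = ⊥-elim (x≢d x≡d)
    ... | no _     | there x∈′ = g≡f x∈′

-- Two-colourings that separate half of a family of pairs

module Cut {A I : Set} (_≟ᴬ_ : DecidableEquality A)
           (a b : I → A) (a≢b : ∀ i → a i ≢ b i) where
  open FiniteMaps _≟ᴬ_ using (update)
  open DecMembership _≟ᴬ_ using (_∈?_)

  clash : Bool → Bool → ℕ
  clash x y = if does (x Bool.≟ y) then 2 else 0

  -- Twice the conditional expectation of "the ends of i get the same colour"
  -- when the vertices in vs are still to be coloured at random.
  load : (A → Bool) → List A → I → ℕ
  load c vs i = if does (a i ∈? vs) ∨ does (b i ∈? vs) then 1 else clash (c (a i)) (c (b i))

  -- By `a≢b` at most one end is `v`. If one is and the pair thereby becomes fully coloured, its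
  -- loads under the two colours are 2 and 0, averaging 1; in all other cases colouring `v` leaves
  -- the load unchanged.
  load-split : ∀ c v vs i →
    load (update v true c) vs i + load (update v false c) vs i ≤ 2 * load c (v ∷ vs) i
  load-split c v vs i with a i ≟ᴬ v | b i ≟ᴬ v
  ... | yes p | yes q = ⊥-elim (a≢b i (trans p (sym q)))
  ... | yes p | no q with does (a i ∈? vs) | does (b i ∈? vs) | c (b i)
  ...   | true  | _     | _     = ≤-refl
  ...   | false | true  | _     = ≤-refl
  ...   | false | false | true  = ≤-refl
  ...   | false | false | false = ≤-refl
  load-split c v vs i | no p | yes q with does (a i ∈? vs) | does (b i ∈? vs) | c (a i)
  ...   | true  | _     | _     = ≤-refl
  ...   | false | true  | _     = ≤-refl
  ...   | false | false | true  = ≤-refl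
  ...   | false | false | false = ≤-refl
  load-split c v vs i | no p | no q with does (a i ∈? vs) | does (b i ∈? vs)
  ...   | true  | _     = ≤-refl
  ...   | false | true  = ≤-refl
  ...   | false | false = ≤-reflexive (cong (clash (c (a i)) (c (b i)) +_) (sym (+-identityʳ _)))

  total : (A → Bool) → List A → List I → ℕ
  total c vs is = sum (map (load c vs) is)

  total-split : ∀ c v vs is →
    total (update v true c) vs is + total (update v false c) vs is ≤ 2 * total c (v ∷ vs) is
  total-split c v vs []       = z≤n
  total-split c v vs (i ∷ is) = begin
    (x + X) + (y + Y)                             ≡⟨ interchange x X y Y ⟩
    (x + y) + (X + Y)                             ≤⟨ +-mono-≤ (load-split c v vs i) (total-split c v vs is) ⟩
    2 * load c (v ∷ vs) i + 2 * total c (v ∷ vs) is ≡⟨ *-distribˡ-+ 2 (load c (v ∷ vs) i) _ ⟨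
    2 * total c (v ∷ vs) (i ∷ is)                 ∎
    where
    open ≤-Reasoning
    x = load (update v true c) vs i
    y = load (update v false c) vs i
    X = total (update v true c) vs is
    Y = total (update v false c) vs is
    interchange : ∀ p q r s → (p + q) + (r + s) ≡ (p + r) + (q + s)
    interchange = solve-∀

  -- The method of conditional expectations: one of the two colours of `v` does not raise the total.
  derandomise : ∀ c vs is → ∃ λ c′ → total c′ [] is ≤ total c vs is
  derandomise c []       is = c , ≤-refl
  derandomise c (v ∷ vs) is
    with total (update v true c) vs is ≤? total c (v ∷ vs) is
  ... | yes le = let c′ , le′ = derandomise (update v true c) vs is in c′ , ≤-trans le′ le
  ... | no ¬le = let c′ , le′ = derandomise (update v false c) vs is in c′ , ≤-trans le′ other
    where
    other : total (update v false c) vs is ≤ total c (v ∷ vs) is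
    other = +-cancelˡ-≤ (total c (v ∷ vs) is) _ _ (begin
      total c (v ∷ vs) is + total (update v false c) vs is               ≤⟨ +-monoˡ-≤ _ (<⇒≤ (≰⇒> ¬le)) ⟩
      total (update v true c) vs is + total (update v false c) vs is     ≤⟨ total-split c v vs is ⟩
      2 * total c (v ∷ vs) is                                            ≡⟨ cong (total c (v ∷ vs) is +_) (+-identityʳ _) ⟩
      total c (v ∷ vs) is + total c (v ∷ vs) is                          ∎)
      where open ≤-Reasoning

  Mono : (A → Bool) → I → Set
  Mono c i = c (a i) ≡ c (b i)

  mono? : ∀ c i → Dec (Mono c i)
  mono? c i = c (a i) Bool.≟ c (b i)

  total-coloured : ∀ c is → total c [] is ≡ 2 * length (filter (mono? c) is)
  total-coloured c []       = refl
  total-coloured c (i ∷ is) with does (mono? c i)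
  ... | true  = trans (cong (2 +_) (total-coloured c is)) (sym (*-suc 2 _))
  ... | false = total-coloured c is

  -- A single uncoloured end already gives an even chance of agreement, hence load 1.
  total-uncoloured : ∀ c vs is → (∀ {i} → i ∈ is → a i ∈ vs) → total c vs is ≡ length is
  total-uncoloured c vs []       cover = refl
  total-uncoloured c vs (i ∷ is) cover with a i ∈? vs
  ... | yes _  = cong suc (total-uncoloured c vs is (cover ∘ there))
  ... | no a∉  = ⊥-elim (a∉ (cover (here refl)))

  half-cut : ∀ is → ∃ λ c → 2 * length (filter (mono? c) is) ≤ length is
  half-cut is with derandomise (λ _ → true) (map a is) is
  ... | c , le = c , (begin
    2 * length (filter (mono? c) is)      ≡⟨ total-coloured c is ⟨
    total c [] is                         ≤⟨ le ⟩
    total (λ _ → true) (map a is) is      ≡⟨ total-uncoloured (λ _ → true) (map a is) is (∈-map⁺ a) ⟩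
    length is                             ∎)
    where open ≤-Reasoning

-- Each level is coloured so as to break at least half of the surviving maps.
break-all : {A I : Set} → DecidableEquality A → (ℓ : A → ℕ) (act : I → A → A) →
  ∀ f (lev : ℕ → ℕ) → (∀ k → lev k < lev (suc k)) →
  (∀ i k → k < f → ∃ λ v → ℓ v ≡ lev k × ℓ (act i v) ≡ lev k × act i v ≢ v) →
  ∀ is → length is < 2 ^ f →
  ∃ λ (c : A → Bool) → ∀ {i} → i ∈ is →
    ∃ λ k → ∃ λ v → k < f × ℓ v ≡ lev k × ℓ (act i v) ≡ lev k × c (act i v) ≢ c v
break-all _≟ᴬ_ ℓ act zero lev lev< moves [] _ = (λ _ → true) , λ ()
break-all _≟ᴬ_ ℓ act zero lev lev< moves (_ ∷ _) (s≤s ())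
break-all {A} {I} _≟ᴬ_ ℓ act (suc f) lev lev< moves is short = c , broken
  where
  moved : I → A
  moved i = proj₁ (moves i 0 z<s)

  -- Each pair is a vertex moved on level `lev 0` and its image; a monochromatic pair means that the
  -- map is not broken there.
  open Cut _≟ᴬ_ (λ i → act i (moved i)) moved (λ i → proj₂ (proj₂ (proj₂ (moves i 0 z<s))))

  d : A → Bool
  d = proj₁ (half-cut is)

  survivors : List I
  survivors = filter (mono? d) is

  rest : ∃ λ (c : A → Bool) → ∀ {i} → i ∈ survivors →
    ∃ λ k → ∃ λ v → k < f × ℓ v ≡ lev (suc k) × ℓ (act i v) ≡ lev (suc k) × c (act i v) ≢ c v
  rest = break-all _≟ᴬ_ ℓ act f (lev ∘ suc) (lev< ∘ suc) (λ i k k<f → moves i (suc k) (s≤s k<f))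
    survivors (*-cancelˡ-< 2 _ _ (≤-<-trans (proj₂ (half-cut is)) short))

  -- The levels increase strictly, so the recursive colouring is only evaluated off `lev 0` and the
  -- two do not conflict.
  c : A → Bool
  c v = if does (ℓ v ≟ lev 0) then d v else proj₁ rest v

  above : ∀ k → lev 0 < lev (suc k)
  above zero    = lev< 0
  above (suc k) = <-trans (above k) (lev< (suc k))

  c-head : ∀ {v} → ℓ v ≡ lev 0 → c v ≡ d v
  c-head {v} eq rewrite dec-true (ℓ v ≟ lev 0) eq = refl

  c-tail : ∀ {v} k → ℓ v ≡ lev (suc k) → c v ≡ proj₁ rest v
  c-tail {v} k eq rewrite dec-false (ℓ v ≟ lev 0) (λ eq₀ → <⇒≢ (above k) (trans (sym eq₀) eq)) = refl

  broken : ∀ {i} → i ∈ is →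
    ∃ λ k → ∃ λ v → k < suc f × ℓ v ≡ lev k × ℓ (act i v) ≡ lev k × c (act i v) ≢ c v
  broken {i} i∈ with mono? d i
  ... | no d≢ = let v , at , at′ , _ = moves i 0 z<s in
    0 , v , z<s , at , at′ , λ c≡ → d≢ (trans (sym (c-head at′)) (trans c≡ (c-head at)))
  ... | yes d≡ with proj₂ rest (∈-filter⁺ (mono? d) i∈ d≡)
  ...   | k , v , k<f , at , at′ , c≢ =
    suc k , v , s≤s k<f , at , at′ , λ c≡ → c≢ (trans (sym (c-tail k at′)) (trans c≡ (c-tail k at)))

-- Estimates: few sphere maps, enough free levels

-- From 2 ^ (s * T) ≤ n ^ (s * T) ≤ 2 ^ (n * Q) follows s ≤ n. Hence s ^ s ≤ n ^ s, whose `T`-th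
-- power is at most 2 ^ (n * Q) < 2 ^ (f * T).
few-maps : ∀ {n l s f Q T} .{{_ : NonZero T}} → 2 ≤ n → Q ≤ T → s ≤ l →
  n ^ (l * T) ≤ 2 ^ (n * Q) → n * Q < f * T → s ^ s < 2 ^ f
few-maps {n} {l} {s} {f} {Q} {T} 2≤n Q≤T s≤l small nQ<fT = ≰⇒> λ many →
  exponent (f * T) (begin
    2 ^ (f * T)   ≡⟨ ^-*-assoc 2 f T ⟨
    (2 ^ f) ^ T   ≤⟨ ^-monoˡ-≤ T many ⟩
    (s ^ s) ^ T   ≤⟨ ^-monoˡ-≤ T (^-monoˡ-≤ s s≤n) ⟩
    (n ^ s) ^ T   ≡⟨ ^-*-assoc n s T ⟩
    n ^ (s * T)   ≤⟨ small′ ⟩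
    2 ^ (n * Q)   ∎) nQ<fT
  where
  open ≤-Reasoning
  instance
    n≢0 : NonZero n
    n≢0 = >-nonZero (≤-trans (s≤s z≤n) 2≤n)
  exponent : ∀ e → 2 ^ e ≤ 2 ^ (n * Q) → ¬ (n * Q < e)
  exponent e le lt = <⇒≱ (^-monoʳ-< 2 (s≤s (s≤s z≤n)) lt) le
  small′ : n ^ (s * T) ≤ 2 ^ (n * Q)
  small′ = ≤-trans (^-monoʳ-≤ n (*-monoˡ-≤ T s≤l)) small
  s≤n : s ≤ n
  s≤n = *-cancelʳ-≤ s n T (≤-trans
    (≮⇒≥ (exponent (s * T) (≤-trans (^-monoˡ-≤ (s * T) 2≤n) small′)))
    (*-monoʳ-≤ n Q≤T))

-- This is where ε > 0 enters. Up to rounding, `f + f / T` is (T + 1) * Q * n / (T * T), and Q < T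
-- gives (T + 1) * Q ≤ T * T - 1. After multiplication by T * T a spare `n` remains, which absorbs
-- the rounding and `A`.
room : ∀ {n Q T} A .{{_ : NonZero T}} → Q < T → T * suc T + T * T * A ≤ n →
  let f = suc (n * Q / T) in A + (f + f / T) ≤ n
room {n} {Q} {T} A Q<T big = *-cancelˡ-≤ (T * T) {{m*n≢0 T T}} (begin
  T * T * (A + (f + f / T))                 ≡⟨ expand T A f (f / T) ⟩
  T * T * A + (T * (f * T) + T * (f / T * T)) ≤⟨ +-monoʳ-≤ (T * T * A) (+-monoʳ-≤ (T * (f * T)) (*-monoʳ-≤ T (m/n*n≤m f T))) ⟩
  T * T * A + (T * (f * T) + T * f)         ≡⟨ cong (T * T * A +_) (collect T f) ⟩
  T * T * A + suc T * (T * f)               ≤⟨ +-monoʳ-≤ (T * T * A) (*-monoʳ-≤ (suc T) fT) ⟩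
  T * T * A + suc T * (T + n * Q)           ≡⟨ regroup T A (n * Q) ⟩
  (T * suc T + T * T * A) + suc T * (n * Q) ≤⟨ +-monoˡ-≤ _ big ⟩
  n + suc T * (n * Q)                       ≡⟨ factor n T Q ⟩
  n * (suc Q + T * Q)                       ≤⟨ *-monoʳ-≤ n (+-monoˡ-≤ (T * Q) Q<T) ⟩
  n * (T + T * Q)                           ≡⟨ cong (n *_) (*-suc T Q) ⟨
  n * (T * suc Q)                           ≤⟨ *-monoʳ-≤ n (*-monoʳ-≤ T Q<T) ⟩
  n * (T * T)                               ≡⟨ *-comm n (T * T) ⟩
  T * T * n                                 ∎)
  where
  open ≤-Reasoning
  f = suc (n * Q / T)
  fT : T * f ≤ T + n * Q
  fT = begin
    T * suc (n * Q / T)   ≡⟨ *-suc T _ ⟩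
    T + T * (n * Q / T)   ≡⟨ cong (T +_) (*-comm T _) ⟩
    T + n * Q / T * T     ≤⟨ +-monoʳ-≤ T (m/n*n≤m (n * Q) T) ⟩
    T + n * Q             ∎
  expand : ∀ t α g h → t * t * (α + (g + h)) ≡ t * t * α + (t * (g * t) + t * (h * t))
  expand = solve-∀
  collect : ∀ t g → t * (g * t) + t * g ≡ suc t * (t * g)
  collect = solve-∀
  regroup : ∀ t α z → t * t * α + suc t * (t + z) ≡ (t * suc t + t * t * α) + suc t * z
  regroup = solve-∀
  factor : ∀ k t r → k + suc t * (k * r) ≡ k * (suc r + t * r)
  factor = solve-∀

n*Q<f*T : ∀ n Q T .{{_ : NonZero T}} → n * Q < suc (n * Q / T) * T
n*Q<f*T n Q T = begin-strict
  n * Q                               ≡⟨ m≡m%n+[m/n]*n (n * Q) T ⟩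
  (n * Q) % T + n * Q / T * T         <⟨ +-monoˡ-< _ (m%n<n (n * Q) T) ⟩
  T + n * Q / T * T                   ∎
  where open ≤-Reasoning

-- Choosing entries and witnesses from lists

pick : {A : Set} → A → List A → ℕ → A
pick d []       _       = d
pick d (x ∷ xs) zero    = x
pick d (x ∷ xs) (suc i) = pick d xs i

pick-∈ : {A : Set} {d x : A} {xs : List A} → x ∈ xs → ∃ λ i → pick d xs i ≡ x
pick-∈ (here refl) = 0 , refl
pick-∈ (there x∈)  = let i , eq = pick-∈ x∈ in suc i , eq

-- One witness is kept per solvable `b`, so a bound on the number of classes bounds the number of
-- representatives.
select : {B I : Set} {R : B → I → Set} → (∀ b → Dec (∃ (R b))) → ∀ bs →
  ∃ λ is → length is ≤ length bs × (∀ {b} → b ∈ bs → ∃ (R b) → ∃ λ i → i ∈ is × R b i)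
select R? []       = [] , z≤n , λ ()
select R? (b ∷ bs) with R? b | select R? bs
... | yes (i , r) | is , le , hit = i ∷ is , s≤s le , λ
  { (here refl) _ → i , here refl , r
  ; (there b∈)  r → let j , j∈ , s = hit b∈ r in j , there j∈ , s }
... | no ¬r | is , le , hit = is , m≤n⇒m≤1+n le , λ
  { (here refl) r → ⊥-elim (¬r r)
  ; (there b∈)  r → hit b∈ r }

-- The prescribed colours of levels

module Pattern (P : ℕ) (3≤P : 3 ≤ P) where

  P<2P : suc P < 2 * P
  P<2P = begin-strict
    suc P     <⟨ +-monoˡ-< P (≤-trans (s≤s (s≤s z≤n)) 3≤P) ⟩
    P + P     ≡⟨ cong (P +_) (+-identityʳ P) ⟨
    2 * P     ∎
    where open ≤-Reasoning

  -- nothing marks the free levels.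
  levelColour : ℕ → Maybe Bool
  levelColour k with k ≤? 1
  ... | yes _ = just true
  ... | no _ with (2 * P ≤? k) ×-dec (P ∣? k)
  ...   | yes _ = just true
  ...   | no _ with k ≤? suc (2 * P)
  ...     | yes _ = just false
  ...     | no _  = nothing

  level-low : ∀ {k} → k ≤ 1 → levelColour k ≡ just true
  level-low {k} k≤1 with k ≤? 1
  ... | yes _  = refl
  ... | no k≰1 = ⊥-elim (k≰1 k≤1)

  level-multiple : ∀ {k} → 2 * P ≤ k → P ∣ k → levelColour k ≡ just true
  level-multiple {k} le P∣k with k ≤? 1
  ... | yes _ = refl
  ... | no _ with (2 * P ≤? k) ×-dec (P ∣? k)
  ...   | yes _ = refl
  ...   | no ¬m = ⊥-elim (¬m (le , P∣k))

  level-white : ∀ {k} → 1 < k → k ≤ suc (2 * P) → ¬ (2 * P ≤ k × P ∣ k) → levelColour k ≡ just false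
  level-white {k} 1<k le ¬m with k ≤? 1
  ... | yes k≤1 = ⊥-elim (<⇒≱ 1<k k≤1)
  ... | no _ with (2 * P ≤? k) ×-dec (P ∣? k)
  ...   | yes m = ⊥-elim (¬m m)
  ...   | no _ with k ≤? suc (2 * P)
  ...     | yes _ = refl
  ...     | no ¬le = ⊥-elim (¬le le)

  level-inner : ∀ {k} → 1 < k → k < 2 * P → levelColour k ≡ just false
  level-inner 1<k k<2P = level-white 1<k (m≤n⇒m≤1+n (<⇒≤ k<2P)) (λ m → <⇒≱ k<2P (proj₁ m))

  level-outer : levelColour (suc (2 * P)) ≡ just false
  level-outer = level-white (s≤s (≤-trans (s≤s z≤n) P<2P)) ≤-refl
    -- Otherwise `P` would divide 2P + 1 and hence 1.
    (λ m → <⇒≱ (≤-trans (s≤s (s≤s z≤n)) 3≤P) (∣⇒≤ (∣m+n∣m⇒∣n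
      (subst (P ∣_) (+-comm 1 (2 * P)) (proj₂ m)) (n∣m*n 2))))

  level-free : ∀ {k} → suc (2 * P) < k → ¬ P ∣ k → levelColour k ≡ nothing
  level-free {k} lt P∤k with k ≤? 1
  ... | yes k≤1 = ⊥-elim (<⇒≱ (≤-<-trans (s≤s z≤n) lt) k≤1)
  ... | no _ with (2 * P ≤? k) ×-dec (P ∣? k)
  ...   | yes m = ⊥-elim (P∤k (proj₂ m))
  ...   | no _ with k ≤? suc (2 * P)
  ...     | yes le = ⊥-elim (<⇒≱ lt le)
  ...     | no _ = refl

  -- `t` is the last multiple of `P` not exceeding k - 2. Thus a vertex on level `k` has a black
  -- vertex at a distance from 2 to P + 1, whereas around v0 these distances show only white.
  multiple-below : ∀ {k} → suc (suc (2 * P)) ≤ k →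
    ∃ λ j → ∃ λ t → k ≡ t + j × 1 < j × j ≤ suc P × 2 * P ≤ t × P ∣ t
  multiple-below {suc (suc r)} (s≤s (s≤s le)) =
    2 + r % P , r / P * P , split , s≤s (s≤s z≤n) , s≤s (m%n<n r P) , below , n∣m*n (r / P)
    where
    instance
      P≢0 : NonZero P
      P≢0 = >-nonZero (≤-trans (s≤s z≤n) 3≤P)
    split : 2 + r ≡ r / P * P + (2 + r % P)
    split = trans (cong (2 +_) (m≡m%n+[m/n]*n r P)) (+-comm (2 + r % P) (r / P * P))
    below : 2 * P ≤ r / P * P
    below = *-monoˡ-≤ P (subst (_≤ r / P) (m*n/n≡m 2 P) (/-monoˡ-≤ P le))

-- Enumerates the numbers above A that are not divisible by suc T, provided suc T ∣ A.
skip : (T A : ℕ) .{{_ : NonZero T}} → ℕ → ℕ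
skip T A k = A + suc (k + k / T)

module _ {T A : ℕ} .{{_ : NonZero T}} where

  skip-< : ∀ k → skip T A k < skip T A (suc k)
  skip-< k = +-monoʳ-< A (s≤s (s≤s (+-monoʳ-≤ k (/-monoˡ-≤ T (n≤1+n k)))))

  skip-≤ : ∀ {k f} → k < f → skip T A k ≤ A + (f + f / T)
  skip-≤ {k} {f} k<f = +-monoʳ-≤ A (+-mono-≤ k<f (/-monoˡ-≤ T (<⇒≤ k<f)))

  -- The offset from `A` is (k / T) * (T + 1) + (k % T + 1), whose last summand lies between 1 and
  -- T.
  skip-∤ : suc T ∣ A → ∀ k → ¬ suc T ∣ skip T A k
  skip-∤ d k d′ = <⇒≱ (s≤s (m%n<n k T)) (∣⇒≤ (∣m+n∣m⇒∣n
    (subst (suc T ∣_) split (∣m+n∣m⇒∣n d′ d)) (n∣m*n (k / T))))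
    where
    regroup : ∀ r h t → suc ((r + h * t) + h) ≡ h * suc t + suc r
    regroup = solve-∀
    split : suc (k + k / T) ≡ k / T * suc T + suc (k % T)
    split = trans (cong (λ z → suc (z + k / T)) (m≡m%n+[m/n]*n k T)) (regroup (k % T) (k / T) T)

-- Distance levels and decidability in a rooted graph

module Rooted (G : Graph) (lf : LocallyFinite G) (conn : Connected G) (v0 : Graph.V G) where
  open Graph G renaming (sym to E-sym)

  neighbours : V → List V
  neighbours v = proj₁ (lf v)

  decode : V → List ℕ → V
  decode u []       = u
  decode u (i ∷ is) = decode (pick u (neighbours u) i) is

  encode : ∀ {u w n} → Walk G u w n → ∃ λ is → decode u is ≡ w
  encode here = [] , refl
  encode {u} {w} (step {v = v} e p) =
    let i , i≡ = pick-∈ {d = u} (Equivalence.to (proj₂ (lf u) v) e)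
        is , is≡ = encode p
    in i ∷ is , trans (cong (λ x → decode x is) i≡) is≡

  code : V → List ℕ
  code w = proj₁ (encode (proj₂ (conn v0 w)))

  decode-code : ∀ w → decode v0 (code w) ≡ w
  decode-code w = proj₂ (encode (proj₂ (conn v0 w)))

  -- A vertex is determined by the neighbour indices along the chosen walk from v0.
  _≟ⱽ_ : DecidableEquality V
  x ≟ⱽ y = map′ (λ eq → trans (sym (decode-code x)) (trans (cong (decode v0) eq) (decode-code y)))
                (cong code) (≡-dec _≟_ (code x) (code y))

  open DecMembership _≟ⱽ_ using (_∈?_)
  open FiniteMaps _≟ⱽ_ using (maps; length-maps; maps-complete)

  edge? : ∀ u w → Dec (E u w)
  edge? u w = map′ (Equivalence.from (proj₂ (lf u) w)) (Equivalence.to (proj₂ (lf u) w))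
                   (w ∈? neighbours u)

  _∙_ : ∀ {u v w m n} → Walk G u v m → Walk G v w n → Walk G u w (m + n)
  here     ∙ q = q
  step e p ∙ q = step e (p ∙ q)

  reverse : ∀ {u w n} → Walk G u w n → Walk G w u n
  reverse here = here
  reverse {n = suc n} (step e p) = subst (Walk G _ _) (+-comm n 1) (reverse p ∙ step (E-sym e) here)

  split : ∀ {u w} i {j} → Walk G u w (i + j) → ∃ λ y → Walk G u y i × Walk G y w j
  split zero    p          = _ , here , p
  split (suc i) (step e p) = let y , p₁ , p₂ = split i p in y , step e p₁ , p₂

  ends : V → ℕ → List V
  ends u zero    = u ∷ []
  ends u (suc k) = concatMap (λ v → ends v k) (neighbours u)

  ends-complete : ∀ {u w k} → Walk G u w k → w ∈ ends u k
  ends-complete here = here refl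
  ends-complete {u} {k = suc k} (step {v = v} e p) =
    ∈-concatMap⁺ (λ v → ends v k) (lose (Equivalence.to (proj₂ (lf u) v) e) (ends-complete p))

  ends-sound : ∀ {u w} k → w ∈ ends u k → Walk G u w k
  ends-sound zero    (here refl) = here
  ends-sound {u} (suc k) w∈ =
    let v , v∈ , w∈′ = find (∈-concatMap⁻ (λ v → ends v k) {neighbours u} w∈)
    in step (Equivalence.from (proj₂ (lf u) v) v∈) (ends-sound k w∈′)

  walk? : ∀ u w k → Dec (Walk G u w k)
  walk? u w k = map′ (ends-sound k) ends-complete (w ∈? ends u k)

  abstract
    distance : ∀ w → ∃ λ k → Walk G v0 w k × (∀ j → j < k → ¬ Walk G v0 w j)
    distance w = let n , p = conn v0 w in least (walk? v0 w) n p

  ℓ : V → ℕ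
  ℓ w = proj₁ (distance w)

  ℓ-walk : ∀ w → Walk G v0 w (ℓ w)
  ℓ-walk w = proj₁ (proj₂ (distance w))

  ℓ-least : ∀ {w k} → Walk G v0 w k → ℓ w ≤ k
  ℓ-least {w} p = ≮⇒≥ (λ lt → proj₂ (proj₂ (distance w)) _ lt p)

  ℓ-unique : ∀ {w k} → Walk G v0 w k → (∀ {i} → Walk G v0 w i → k ≤ i) → ℓ w ≡ k
  ℓ-unique {w} p least = ≤-antisym (ℓ-least p) (least (ℓ-walk w))

  ℓ-triangle : ∀ {y x j} → Walk G y x j → ℓ x ≤ ℓ y + j
  ℓ-triangle {y} p = ℓ-least (ℓ-walk y ∙ p)

  ℓ-edge : ∀ {u w} → E u w → ℓ w ≤ suc (ℓ u)
  ℓ-edge {u} {w} e = subst (ℓ w ≤_) (+-comm (ℓ u) 1) (ℓ-triangle (step e here))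

  -- A shortest walk is cut after `i` steps; a cut vertex on a lower level would bring `x` below
  -- level i + j.
  geodesic : ∀ {x} i j → ℓ x ≡ i + j → ∃ λ y → ℓ y ≡ i × Walk G y x j
  geodesic {x} i j eq with split i (subst (Walk G v0 x) eq (ℓ-walk x))
  ... | y , p , q = y , ≤-antisym (ℓ-least p) (+-cancelʳ-≤ j i (ℓ y) (subst (_≤ ℓ y + j) eq (ℓ-triangle q))) , q

  ℓ-near : ∀ y → ℓ y ≤ 1 → y ≡ v0 ⊎ E v0 y
  ℓ-near y le with ℓ y | ℓ-walk y
  ... | zero  | here = inj₁ refl
  ... | suc zero | step e here = inj₂ e
  ℓ-near y (s≤s ()) | suc (suc _) | _

  ball : ℕ → List V
  ball n = concatMap (ends v0) (upTo (suc n))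

  ball-complete : ∀ {v n} → ℓ v ≤ n → v ∈ ball n
  ball-complete {v} le =
    ∈-concatMap⁺ (ends v0) (lose (∈-upTo⁺ (s≤s le)) (ends-complete (ℓ-walk v)))

  ball-sound : ∀ {v n} → v ∈ ball n → ℓ v ≤ n
  ball-sound {v} {n} v∈ with find (∈-concatMap⁻ (ends v0) {upTo (suc n)} v∈)
  ... | k , k∈ , v∈′ = ≤-trans (ℓ-least (ends-sound k v∈′)) (≤-pred (∈-upTo⁻ k∈))

  someBall? : {Q : V → Set} → ∀ n → (∀ v → Dec (Q v)) → Dec (∃ λ v → ℓ v ≤ n × Q v)
  someBall? n Q? = map′
    (λ p → let v , v∈ , q = find p in v , ball-sound v∈ , q)
    (λ { (v , le , q) → lose (ball-complete le) q })
    (any? Q? (ball n))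

  allBall? : {Q : V → Set} → ∀ n → (∀ v → Dec (Q v)) → Dec (∀ v → ℓ v ≤ n → Q v)
  allBall? n Q? with someBall? n (¬? ∘ Q?)
  ... | yes (v , le , ¬q) = no λ all → ¬q (all v le)
  ... | no none = yes λ v le → decidable-stable (Q? v) (λ ¬q → none (v , le , ¬q))

  -- Automorphisms of balls

  Half : ℕ → (f g : V → V) → Set
  Half n f g = ∀ v → ℓ v ≤ n →
    ℓ (f v) ≡ ℓ v × f (g v) ≡ v × (∀ w → ℓ w ≤ n → E v w → E (f v) (f w))

  -- The maps are total but constrained only on the ball, where they are mutually inverse and keep
  -- levels. Both preserve edges, so both reflect them.
  BallAut : ℕ → (f g : V → V) → Set
  BallAut n f g = Half n f g × Half n g f

  half? : ∀ n f g → Dec (Half n f g)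
  half? n f g = allBall? n λ v → (ℓ (f v) ≟ ℓ v) ×-dec (f (g v) ≟ⱽ v) ×-dec
    allBall? n λ w → edge? v w →-dec edge? (f v) (f w)

  ballAut? : ∀ n f g → Dec (BallAut n f g)
  ballAut? n f g = half? n f g ×-dec half? n g f

  half-level : ∀ {n f g v} → Half n f g → ℓ v ≤ n → ℓ (f v) ≤ n
  half-level {n} {v = v} h le = subst (_≤ n) (sym (proj₁ (h v le))) le

  half-∘ : ∀ {n f g f′ g′} → Half n f g → Half n g′ f′ → Half n f′ g′ → Half n (f′ ∘ f) (g ∘ g′)
  half-∘ {n} {f} {g} {f′} {g′} h k′ h′ v le =
    trans (proj₁ (h′ (f v) fv≤)) (proj₁ (h v le)) ,
    trans (cong f′ (proj₁ (proj₂ (h (g′ v) (half-level k′ le))))) (proj₁ (proj₂ (h′ v le))) ,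
    λ w w≤ e → proj₂ (proj₂ (h′ (f v) fv≤)) (f w) (half-level h w≤) (proj₂ (proj₂ (h v le)) w w≤ e)
    where fv≤ = half-level h le

  half-cong : ∀ {n f g f′ g′} → (∀ v → ℓ v ≤ n → f′ v ≡ f v) → (∀ v → ℓ v ≤ n → g′ v ≡ g v) →
    Half n g f → Half n f g → Half n f′ g′
  half-cong {f′ = f′} f≡ g≡ k h v le =
    trans (cong ℓ (f≡ v le)) (proj₁ (h v le)) ,
    trans (cong f′ (g≡ v le)) (trans (f≡ _ (half-level k le)) (proj₁ (proj₂ (h v le)))) ,
    λ w w≤ e → subst₂ E (sym (f≡ v le)) (sym (f≡ w w≤)) (proj₂ (proj₂ (h v le)) w w≤ e)

  half-restrict : ∀ {k n f g} → k ≤ n → Half n f g → Half k f g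
  half-restrict k≤n h v le = let a , b , e = h v (≤-trans le k≤n) in
    a , b , λ w w≤ → e w (≤-trans w≤ k≤n)

  extend : ℕ → (V → V) → V → V
  extend n f v with ℓ v ≤? n
  ... | yes _ = f v
  ... | no _  = v

  extend-in : ∀ {n f v} → ℓ v ≤ n → extend n f v ≡ f v
  extend-in {n} {f} {v} le with ℓ v ≤? n
  ... | yes _ = refl
  ... | no ¬le = ⊥-elim (¬le le)

  extend-out : ∀ {n f v} → ¬ ℓ v ≤ n → extend n f v ≡ v
  extend-out {n} {f} {v} ¬le with ℓ v ≤? n
  ... | yes le = ⊥-elim (¬le le)
  ... | no _ = refl

  extend-inverse : ∀ {n f g} → Half n f g → Half n g f → ∀ v → extend n f (extend n g v) ≡ v
  extend-inverse {n} {f} {g} h k v with ℓ v ≤? n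
  ... | yes le = trans (extend-in (half-level k le)) (proj₁ (proj₂ (h v le)))
  ... | no ¬le = extend-out ¬le

  FixesSphere : ℕ → (V → V) → Set
  FixesSphere n f = ∀ v → ℓ v ≡ n → f v ≡ v

  -- An edge leaving the ball starts on its boundary sphere, which is fixed pointwise.
  extend-edge : ∀ {n f g} → Half n f g → FixesSphere n f →
    ∀ {u w} → E u w → E (extend n f u) (extend n f w)
  extend-edge {n} {f} h fix {u} {w} e with ℓ u ≤? n | ℓ w ≤? n
  ... | yes u≤ | yes w≤ = proj₂ (proj₂ (h u u≤)) w w≤ e
  ... | yes u≤ | no w≰ = subst (λ x → E x w)
    (sym (fix u (≤-antisym u≤ (≤-pred (≤-trans (≰⇒> w≰) (ℓ-edge e)))))) e
  ... | no u≰ | yes w≤ = subst (E u)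
    (sym (fix w (≤-antisym w≤ (≤-pred (≤-trans (≰⇒> u≰) (ℓ-edge (E-sym e))))))) e
  ... | no _ | no _ = e

  mkAut : (to from : V → V) → (∀ v → to (from v) ≡ v) → (∀ v → from (to v) ≡ v) →
    (∀ {u w} → E u w → E (to u) (to w)) → (∀ {u w} → E u w → E (from u) (from w)) → Aut G
  mkAut to from to-from from-to pres pres⁻¹ = record
    { to = to ; from = from ; to-from = to-from ; from-to = from-to
    ; hom = λ u w → mk⇔ pres (λ e → subst₂ E (from-to u) (from-to w) (pres⁻¹ e)) }

  _⁻¹ : Aut G → Aut G
  φ ⁻¹ = record
    { to = φ.from ; from = φ.to ; to-from = φ.from-to ; from-to = φ.to-from
    ; hom = λ u w → mk⇔
        (λ e → Equivalence.from (φ.hom _ _) (subst₂ E (sym (φ.to-from u)) (sym (φ.to-from w)) e))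
        (λ e → subst₂ E (φ.to-from u) (φ.to-from w) (Equivalence.to (φ.hom _ _) e)) }
    where module φ = Aut φ

  aut-edge : ∀ (φ : Aut G) {u w} → E u w → E (Aut.to φ u) (Aut.to φ w)
  aut-edge φ = Equivalence.to (Aut.hom φ _ _)

  aut-walk : ∀ (φ : Aut G) {u w n} → Walk G u w n → Walk G (Aut.to φ u) (Aut.to φ w) n
  aut-walk φ here       = here
  aut-walk φ (step e p) = step (aut-edge φ e) (aut-walk φ p)

  fixed-level : ∀ (φ : Aut G) → Aut.to φ v0 ≡ v0 → ∀ v → ℓ (Aut.to φ v) ≤ ℓ v
  fixed-level φ fix v = ℓ-least (subst (λ x → Walk G x _ _) fix (aut-walk φ (ℓ-walk v)))

  inverse-fixes : ∀ (φ : Aut G) {v} → Aut.to φ v ≡ v → Aut.from φ v ≡ v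
  inverse-fixes φ {v} fix = trans (cong (Aut.from φ) (sym fix)) (Aut.from-to φ v)

  fixed-half : ∀ (φ : Aut G) → Aut.to φ v0 ≡ v0 → ∀ n → Half n (Aut.to φ) (Aut.from φ)
  fixed-half φ fix n v _ =
    ≤-antisym (fixed-level φ fix v)
      (subst (_≤ ℓ (Aut.to φ v)) (cong ℓ (Aut.from-to φ v)) (fixed-level (φ ⁻¹) (inverse-fixes φ fix) (Aut.to φ v))) ,
    Aut.to-from φ v , λ w _ → aut-edge φ

  fixed-ballAut : ∀ (φ : Aut G) → Aut.to φ v0 ≡ v0 → ∀ n → BallAut n (Aut.to φ) (Aut.from φ)
  fixed-ballAut φ fix n = fixed-half φ fix n , fixed-half (φ ⁻¹) (inverse-fixes φ fix) n

  -- Consequences of infinite motion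

  module _ (motion : InfiniteMotion G) where

    finite-support : ∀ (φ : Aut G) xs → (∀ v → v ∉ xs → Aut.to φ v ≡ v) → ∀ v → Aut.to φ v ≡ v
    finite-support φ xs fix v = decidable-stable (Aut.to φ v ≟ⱽ v) λ moved →
      let w , w∉ , w-moved = motion φ (v , moved) xs in w-moved (fix w w∉)

    rigid : ∀ {n f g} → BallAut n f g → FixesSphere n f → ∀ v → ℓ v ≤ n → f v ≡ v
    rigid {n} {f} {g} (h , k) fix v le = trans (sym (extend-in le))
      (finite-support
        (mkAut (extend n f) (extend n g) (extend-inverse h k) (extend-inverse k h)
          (extend-edge h fix) (extend-edge k fix⁻¹))
        (ball n) (λ w w∉ → extend-out (w∉ ∘ ball-complete)) v)
      where
      fix⁻¹ : FixesSphere n g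
      fix⁻¹ w eq = trans (cong g (sym (fix w eq))) (proj₁ (proj₂ (k w (≤-reflexive eq))))

    -- The composite `g′ ∘ f` fixes the sphere pointwise, so it is the identity on the ball by
    -- `rigid`; applying `f′` finishes.
    determined : ∀ {n f g f′ g′} → BallAut n f g → BallAut n f′ g′ →
      (∀ v → ℓ v ≡ n → f v ≡ f′ v) → ∀ v → ℓ v ≤ n → f v ≡ f′ v
    determined {n} {f} {g} {f′} {g′} (h , k) (h′ , k′) agree v le =
      trans (sym (proj₁ (proj₂ (h′ (f v) (half-level h le)))))
        (cong f′ (rigid (half-∘ h h′ k′ , half-∘ h′ h k) fix v le))
      where
      fix : FixesSphere n (g′ ∘ f)
      fix w eq = trans (cong g′ (agree w eq)) (proj₁ (proj₂ (k′ w (≤-reflexive eq))))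

    -- If the sphere of radius `k` were fixed pointwise, `rigid` would make the restriction to its
    -- ball trivial, and that ball contains the moved vertex.
    moves-spheres : ∀ {m k n f g} → m ≤ k → k ≤ n → BallAut n f g →
      (∃ λ v → ℓ v ≤ m × f v ≢ v) → ∃ λ v → ℓ v ≡ k × f v ≢ v
    moves-spheres {k = k} {f = f} m≤k k≤n (h , h⁻¹) (u , u≤ , moved)
      with someBall? k (λ v → (ℓ v ≟ k) ×-dec ¬? (f v ≟ⱽ v))
    ... | yes (v , _ , eq , mv) = v , eq , mv
    ... | no none = ⊥-elim (moved (rigid (half-restrict k≤n h , half-restrict k≤n h⁻¹)
      (λ v eq → decidable-stable (f v ≟ⱽ v) (λ mv → none (v , ≤-reflexive eq , eq , mv)))
      u (≤-trans u≤ m≤k)))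

    swap : V → V → V → V
    swap x y u with u ≟ⱽ x | u ≟ⱽ y
    ... | yes _ | _     = y
    ... | no _  | yes _ = x
    ... | no _  | no _  = u

    swap-involutive : ∀ x y u → swap x y (swap x y u) ≡ u
    swap-involutive x y u with u ≟ⱽ x | u ≟ⱽ y
    swap-involutive x y u | yes refl | _ with y ≟ⱽ x | y ≟ⱽ y
    ... | yes y≡x | _     = y≡x
    ... | no _    | yes _ = refl
    ... | no _    | no ≢  = ⊥-elim (≢ refl)
    swap-involutive x y u | no _ | yes refl with x ≟ⱽ x
    ... | yes _ = refl
    ... | no ≢  = ⊥-elim (≢ refl)
    swap-involutive x y u | no u≢x | no u≢y with u ≟ⱽ x | u ≟ⱽ y
    ... | yes u≡x | _       = ⊥-elim (u≢x u≡x)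
    ... | no _    | yes u≡y = ⊥-elim (u≢y u≡y)
    ... | no _    | no _    = refl

    swap-outside : ∀ {x y u} → u ∉ x ∷ y ∷ [] → swap x y u ≡ u
    swap-outside {x} {y} {u} u∉ with u ≟ⱽ x | u ≟ⱽ y
    ... | yes p | _     = ⊥-elim (u∉ (here p))
    ... | no _  | yes p = ⊥-elim (u∉ (there (here p)))
    ... | no _  | no _  = refl

    -- The hypotheses say that `x` and `y` have the same closed neighbourhood, so swapping them is
    -- an automorphism of finite support.
    no-twins : ∀ {x y} → E x y → (∀ {u} → E x u → u ≡ y ⊎ E y u) → (∀ {u} → E y u → u ≡ x ⊎ E x u) → ⊥
    no-twins {x} {y} xy x⊆y y⊆x = y≢x (trans (sym swap-x) (finite-support τ (x ∷ y ∷ []) (λ _ → swap-outside) x))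
      where
      y≢x : y ≢ x
      y≢x refl = irrefl xy

      swap-x : swap x y x ≡ y
      swap-x with x ≟ⱽ x
      ... | yes _ = refl
      ... | no ≢  = ⊥-elim (≢ refl)

      other : ∀ {a b u : V} → u ≢ b → u ≡ b ⊎ E a u → E a u
      other u≢b (inj₁ u≡b) = ⊥-elim (u≢b u≡b)
      other u≢b (inj₂ e)   = e

      swap-edge : ∀ {u w} → E u w → E (swap x y u) (swap x y w)
      swap-edge {u} {w} e with u ≟ⱽ x | u ≟ⱽ y | w ≟ⱽ x | w ≟ⱽ y
      ... | yes refl | _        | yes refl | _        = ⊥-elim (irrefl e)
      ... | yes refl | _        | no _     | yes refl = E-sym e
      ... | yes refl | _        | no _     | no w≢y   = other w≢y (x⊆y e)
      ... | no _     | yes refl | yes refl | _        = E-sym e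
      ... | no _     | yes refl | no _     | yes refl = ⊥-elim (irrefl e)
      ... | no _     | yes refl | no w≢x   | no _     = other w≢x (y⊆x e)
      ... | no _     | no u≢y   | yes refl | _        = E-sym (other u≢y (x⊆y (E-sym e)))
      ... | no u≢x   | no _     | no _     | yes refl = E-sym (other u≢x (y⊆x (E-sym e)))
      ... | no _     | no _     | no _     | no _     = e

      τ : Aut G
      τ = mkAut (swap x y) (swap x y) (swap-involutive x y) (swap-involutive x y) swap-edge swap-edge

    -- Recognising the root from the prescribed colours

    module Centre (P : ℕ) (3≤P : 3 ≤ P) (c : V → Bool)
                  (fits : ∀ v {b} → Pattern.levelColour P 3≤P (ℓ v) ≡ just b → c v ≡ b) where
      open Pattern P 3≤P

      Preserves : Aut G → Set
      Preserves φ = ∀ v → c (Aut.to φ v) ≡ c v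

      preserves⁻¹ : ∀ φ → Preserves φ → Preserves (φ ⁻¹)
      preserves⁻¹ φ keep v = trans (sym (keep (Aut.from φ v))) (cong c (Aut.to-from φ v))

      black-white : ∀ {v} → c v ≡ true → c v ≡ false → ⊥
      black-white black white = case trans (sym black) white of λ ()

      3≤2P : 3 ≤ 2 * P
      3≤2P = ≤-trans 3≤P (≤-trans (n≤1+n P) (<⇒≤ P<2P))

      level-zero : ℓ v0 ≡ 0
      level-zero = n≤0⇒n≡0 (ℓ-least here)

      module Image (φ : Aut G) (keep : Preserves φ) where

        x : V
        x = Aut.to φ v0

        -- Together with `push`: distances from `x` are distances from v0 to preimages, so the
        -- colours around `x` repeat those around v0.
        pull : ∀ {y j} → Walk G x y j → Walk G v0 (Aut.from φ y) j
        pull p = subst (λ u → Walk G u _ _) (Aut.from-to φ v0) (aut-walk (φ ⁻¹) p)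

        push : ∀ {y j} → Walk G v0 (Aut.from φ y) j → Walk G x y j
        push p = subst (λ u → Walk G x u _) (Aut.to-from φ _) (aut-walk φ p)

        x-black : c x ≡ true
        x-black = trans (keep v0) (fits v0 (level-low (≤-trans (≤-reflexive level-zero) z≤n)))

        near-black : ∀ {y} → E x y → c y ≡ true
        near-black {y} e = trans (sym (preserves⁻¹ φ keep y))
          (fits (Aut.from φ y) (level-low (ℓ-least (pull (step e here)))))

        far-white : ∀ {y j} → 1 < j → j ≤ suc P → Walk G x y j → (∀ {i} → Walk G x y i → j ≤ i) → c y ≡ false
        far-white {y} 1<j j≤ p shortest = trans (sym (preserves⁻¹ φ keep y))
          (fits (Aut.from φ y) (trans (cong levelColour (ℓ-unique (pull p) (shortest ∘ push)))
            (level-inner 1<j (≤-<-trans j≤ P<2P))))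

        predecessor : ∀ {k} → ℓ x ≡ suc k → ∃ λ y → ℓ y ≡ k × E x y
        predecessor {k} eq with geodesic k 1 (trans eq (+-comm 1 k))
        ... | y , at , step e here = y , at , E-sym e

        not-after-white : ∀ {k} → ℓ x ≡ suc k → levelColour k ≡ just false → ⊥
        not-after-white eq white = let y , at , e = predecessor eq in
          black-white (near-black e) (fits y (trans (cong levelColour at) white))

        -- Levels 2 to 2P - 1 and 2P + 1 are white, but `x` is black. On level 2P it would have a
        -- white neighbour on level 2P - 1. Beyond 2P + 1, `multiple-below` yields a black vertex at
        -- a distance from `x` where all is white.
        level≤1 : ℓ x ≤ 1
        level≤1 with ℓ x ≤? 1
        ... | yes le = le
        ... | no ≰1 with ℓ x <? 2 * P
        ...   | yes lt = ⊥-elim (black-white x-black (fits x (level-inner (≰⇒> ≰1) lt)))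
        ...   | no ≮2P with ℓ x ≟ 2 * P
        ...     | yes eq = ⊥-elim (not-after-white {k = pred (2 * P)} (trans eq (sym (suc-pred (2 * P) {{2P≢0}})))
                    (level-inner (pred-mono-≤ 3≤2P)
                      (≤-reflexive (suc-pred (2 * P) {{2P≢0}}))))
          where
          2P≢0 : NonZero (2 * P)
          2P≢0 = >-nonZero (≤-trans (s≤s z≤n) P<2P)
        ...     | no ≢2P with ℓ x ≟ suc (2 * P)
        ...       | yes eq = ⊥-elim (black-white x-black (fits x (trans (cong levelColour eq) level-outer)))
        ...       | no ≢2P+1 with multiple-below (≤∧≢⇒< (≤∧≢⇒< (≮⇒≥ ≮2P) (≢2P ∘ sym)) (≢2P+1 ∘ sym))
        ...         | j , t , ℓx≡ , 1<j , j≤ , 2P≤t , P∣t with geodesic t j ℓx≡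
        ...           | y , at , p = ⊥-elim (black-white
                          (fits y (trans (cong levelColour at) (level-multiple 2P≤t P∣t)))
                          (far-white 1<j j≤ (reverse p) shortest))
          where
          shortest : ∀ {i} → Walk G x y i → j ≤ i
          shortest {i} q = +-cancelˡ-≤ t j i
            (subst₂ (λ a b → a ≤ b + i) ℓx≡ at (ℓ-triangle (reverse q)))

        -- A neighbour of `x` is black and on level at most 2, while level 2 is white.
        confined : ∀ {y} → E x y → y ≡ v0 ⊎ E v0 y
        confined {y} e = ℓ-near y (≤-pred (≤∧≢⇒< (≤-trans (ℓ-edge e) (s≤s level≤1)) λ eq →
          black-white (near-black e) (fits y (trans (cong levelColour eq) (level-inner ≤-refl 3≤2P)))))

      centre-fixed : ∀ φ → Preserves φ → Aut.to φ v0 ≡ v0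
      centre-fixed φ keep with ℓ-near _ (Image.level≤1 φ keep)
      ... | inj₁ eq = eq
      ... | inj₂ e  = ⊥-elim (no-twins e around (Image.confined φ keep))
        where
        -- Confinement for the inverse, carried over by `φ`, gives the opposite inclusion of closed
        -- neighbourhoods.
        around : ∀ {u} → E v0 u → u ≡ Aut.to φ v0 ⊎ E (Aut.to φ v0) u
        around {u} e with Image.confined (φ ⁻¹) (preserves⁻¹ φ keep) (aut-edge (φ ⁻¹) e)
        ... | inj₁ eq = inj₁ (trans (sym (Aut.to-from φ u)) (cong (Aut.to φ) eq))
        ... | inj₂ e′ = inj₂ (subst (E _) (Aut.to-from φ u) (aut-edge φ e′))

    -- Breaking all ball automorphisms within one annulus

    module Stages (Q T : ℕ) (Q<T : Q < T) (2≤T : 2 ≤ T)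
                  (small : ∀ m → ∃ λ n → n ≥ m × 2 ≤ n × Σ (List V) λ xs →
                    (∀ w → InSphere G v0 n w → w ∈ xs) × n ^ (length xs * T) ≤ 2 ^ (n * Q)) where

      -- Period T + 1 leaves free levels of density T / (T + 1), which exceeds the required Q / T.
      P : ℕ
      P = suc T

      3≤P : 3 ≤ P
      3≤P = s≤s 2≤T

      instance
        T≢0 : NonZero T
        T≢0 = >-nonZero (≤-trans (s≤s z≤n) 2≤T)

      open Pattern P 3≤P

      -- The witness and its image share a free level beyond `m`, so neither the prescribed colours
      -- nor those of earlier annuli interfere.
      Breaks : ℕ → ℕ → (V → Bool) → Set
      Breaks m n c = ∀ f g → BallAut n f g → (∃ λ v → ℓ v ≤ m × f v ≢ v) →
        ∃ λ v → m < ℓ v × ℓ v ≤ n × ℓ (f v) ≡ ℓ v × levelColour (ℓ v) ≡ nothing × c (f v) ≢ c v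

      module Sphere (m n : ℕ) (ys : List V) (∈ys : ∀ {v} → ℓ v ≡ n → v ∈ ys)
                    (ys⊆ : ∀ {v} → v ∈ ys → ℓ v ≡ n) where

        Agrees : (V → V) → (V → V) → Set
        Agrees t f = ∀ v → ℓ v ≤ n → ℓ v ≡ n → t v ≡ f v

        Realises : (V → V) → (V → V) × (V → V) → Set
        Realises t (f , g) = BallAut n f g × (∃ λ v → ℓ v ≤ m × f v ≢ v) × Agrees t f

        realises? : ∀ t fg → Dec (Realises t fg)
        realises? t (f , g) = ballAut? n f g ×-dec someBall? m (λ v → ¬? (f v ≟ⱽ v)) ×-dec
          allBall? n (λ v → (ℓ v ≟ n) →-dec (t v ≟ⱽ f v))

        selfmaps : List (V → V)
        selfmaps = maps v0 (ball n) (ball n)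

        tabulate : ∀ {f g} → Half n f g → ∃ λ f′ → f′ ∈ selfmaps × (∀ v → ℓ v ≤ n → f′ v ≡ f v)
        tabulate {f} h =
          let f′ , f′∈ , eq = maps-complete v0 (ball n) (ball n) f
                (λ d∈ → ball-complete (half-level h (ball-sound d∈)))
          in f′ , f′∈ , λ v le → eq (ball-complete le)

        -- `Realises` depends only on values on the ball, so a search through finitely many
        -- tabulated pairs decides it.
        realisable? : m ≤ n → ∀ t → Dec (∃ (Realises t))
        realisable? m≤n t = map′ (λ r → let fg , _ , real = find r in fg , real) listed
          (any? (realises? t) (cartesianProduct selfmaps selfmaps))
          where
          listed : ∃ (Realises t) → Any (Realises t) (cartesianProduct selfmaps selfmaps)
          listed ((f , g) , (h , k) , (u , u≤ , moved) , agree) =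
            let f′ , f′∈ , f≡ = tabulate h
                g′ , g′∈ , g≡ = tabulate k
            in lose (∈-cartesianProduct⁺ f′∈ g′∈)
                 ( (half-cong f≡ g≡ k h , half-cong g≡ f≡ h k)
                 , (u , u≤ , λ eq → moved (trans (sym (f≡ u (≤-trans u≤ m≤n))) eq))
                 , λ v le eq → trans (agree v le eq) (sym (f≡ v le)) )

        Item : Set
        Item = ∃ λ t → ∃ (Realises t)

        act : Item → V → V
        act i = proj₁ (proj₁ (proj₂ i))

        -- By rigidity, a ball automorphism is recorded by its restriction to the sphere.
        representatives : m ≤ n → ∃ λ (is : List Item) →
          length is ≤ length ys ^ length ys ×
          (∀ f g → BallAut n f g → (∃ λ v → ℓ v ≤ m × f v ≢ v) →
            ∃ λ i → i ∈ is × (∀ v → ℓ v ≤ n → f v ≡ act i v))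
        representatives m≤n
          with select {R = λ t i → proj₁ i ≡ t}
                 (λ t → map′ (λ r → (t , r) , refl) (λ { ((_ , r) , refl) → r }) (realisable? m≤n t))
                 (maps v0 ys ys)
        ... | is , le , hit = is , subst (length is ≤_) (length-maps v0 ys ys) le , represent
          where
          represent : ∀ f g → BallAut n f g → (∃ λ v → ℓ v ≤ m × f v ≢ v) →
            ∃ λ i → i ∈ is × (∀ v → ℓ v ≤ n → f v ≡ act i v)
          represent f g (h , k) moved
            -- Levels are preserved, so `f` restricts to a self-map of the sphere.
            with maps-complete v0 ys ys f
                   (λ {d} d∈ → ∈ys (trans (proj₁ (h d (≤-reflexive (ys⊆ d∈)))) (ys⊆ d∈)))
          ... | t , t∈ , t≡f
            with hit t∈ ((t , (f , g) , (h , k) , moved , λ v _ eq → t≡f (∈ys eq)) , refl)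
          ...   | i@(_ , _ , ba′ , _ , agree) , i∈ , refl = i , i∈ ,
            determined (h , k) ba′ λ v eq →
              trans (sym (t≡f (∈ys eq))) (agree v (≤-reflexive eq) eq)

        -- `break-all` breaks the representatives at vertices of the ball, where every other map
        -- agrees with its representative.
        break-sphere : m ≤ n → ∀ {f} (lev : ℕ → ℕ) → (∀ k → lev k < lev (suc k)) →
          (∀ k → m < lev k) → (∀ {k} → k < f → lev k ≤ n) → (∀ k → levelColour (lev k) ≡ nothing) →
          length ys ^ length ys < 2 ^ f → ∃ (Breaks m n)
        break-sphere m≤n {f} lev lev< lower upper free few with representatives m≤n
        ... | is , is≤ , represent with break-all _≟ⱽ_ ℓ act f lev lev< moves is (≤-<-trans is≤ few)
          where
          moves : ∀ i k → k < f → ∃ λ v → ℓ v ≡ lev k × ℓ (act i v) ≡ lev k × act i v ≢ v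
          moves (_ , _ , ba , moved , _) k k<f =
            let v , at , mv = moves-spheres (<⇒≤ (lower k)) (upper k<f) ba moved
            in v , at , trans (proj₁ (proj₁ ba v (≤-trans (≤-reflexive at) (upper k<f)))) at , mv
        ...   | c , broken = c , breaks
          where
          breaks : Breaks m n c
          breaks φ g ba moved =
            let i , i∈ , same = represent φ g ba moved
                k , v , k<f , at , at′ , c≢ = broken i∈
                v≤ = ≤-trans (≤-reflexive at) (upper k<f)
            in v , subst (m <_) (sym at) (lower k) , v≤ ,
               trans (cong ℓ (same v v≤)) (trans at′ (sym at)) ,
               trans (cong levelColour at) (free k) ,
               λ c≡ → c≢ (trans (cong c (sym (same v v≤))) c≡)

      abstract
        stage : ∀ m → ∃ λ n → m < n × ∃ (Breaks m n)
        -- The lower bound on `n` is what `room` requires for the `A` chosen below.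
        stage m with small (T * suc T + T * T * (P * (3 + m)))
        ... | n , big , 2≤n , xs , covers , sparse =
          n , m<n , Sphere.break-sphere m n ys ∈ys ys⊆ (<⇒≤ m<n) {f} (skip T A) (skip-< {T} {A})
            (λ k → <-trans m<A (lev-lower k)) (λ k<f → ≤-trans (skip-≤ {T} {A} k<f) roomy) lev-free
            (few-maps {f = f} 2≤n (<⇒≤ Q<T) (length-filter at-n? xs) sparse (n*Q<f*T n Q T))
          where
          A f : ℕ
          -- A multiple of `P`, as `skip` requires, above both `m` and 2P + 1.
          A = P * (3 + m)
          f = suc (n * Q / T)

          roomy : A + (f + f / T) ≤ n
          roomy = room A Q<T big

          m<A : m < A
          m<A = ≤-trans (s≤s (m≤n+m m 2)) (m≤n*m (3 + m) P)

          m<n : m < n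
          m<n = ≤-trans m<A (m+n≤o⇒m≤o A roomy)

          at-n? : ∀ v → Dec (ℓ v ≡ n)
          at-n? v = ℓ v ≟ n

          -- The covering list may contain vertices off the sphere; without them, level-preserving
          -- maps take `ys` to itself.
          ys : List V
          ys = filter at-n? xs

          ∈ys : ∀ {v} → ℓ v ≡ n → v ∈ ys
          ∈ys {v} refl = ∈-filter⁺ at-n? (covers v (ℓ-walk v , λ j j< w → <⇒≱ j< (ℓ-least w))) refl

          ys⊆ : ∀ {v} → v ∈ ys → ℓ v ≡ n
          ys⊆ v∈ = proj₂ (∈-filter⁻ at-n? {xs = xs} v∈)

          lev-lower : ∀ k → A < skip T A k
          lev-lower k = m<m+n A z<s

          lev-free : ∀ k → levelColour (skip T A k) ≡ nothing
          lev-free k = level-free (≤-<-trans above (lev-lower k)) (skip-∤ (m∣m*n (3 + m)) k)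
            where
            above : suc (2 * P) ≤ A
            above = begin
              suc (2 * P)     ≤⟨ +-monoˡ-≤ (2 * P) (s≤s z≤n) ⟩
              P + 2 * P       ≡⟨ *-comm 3 P ⟩
              P * 3           ≤⟨ *-monoʳ-≤ P (m≤m+n 3 m) ⟩
              A               ∎
              where open ≤-Reasoning

      -- Gluing the annuli into one colouring

      radius : ℕ → ℕ
      radius zero    = 0
      radius (suc i) = proj₁ (stage (radius i))

      radius-< : ∀ i → radius i < radius (suc i)
      radius-< i = proj₁ (proj₂ (stage (radius i)))

      i≤radius : ∀ i → i ≤ radius i
      i≤radius zero    = z≤n
      i≤radius (suc i) = ≤-<-trans (i≤radius i) (radius-< i)

      stageColour : ℕ → V → Bool
      stageColour i = proj₁ (proj₂ (proj₂ (stage (radius i))))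

      partialColour : ℕ → V → Bool
      partialColour zero    v = true
      partialColour (suc i) v = if does (ℓ v ≤? radius i) then partialColour i v else stageColour i v

      partial-old : ∀ i {v} → ℓ v ≤ radius i → partialColour (suc i) v ≡ partialColour i v
      partial-old i {v} le rewrite dec-true (ℓ v ≤? radius i) le = refl

      partial-new : ∀ i {v} → radius i < ℓ v → partialColour (suc i) v ≡ stageColour i v
      partial-new i {v} lt rewrite dec-false (ℓ v ≤? radius i) (<⇒≱ lt) = refl

      partial-stable : ∀ {i j v} → i ≤′ j → ℓ v ≤ radius i →
        ℓ v ≤ radius j × partialColour j v ≡ partialColour i v
      partial-stable ≤′-refl le = le , refl
      partial-stable (≤′-step {n = j} i≤j) le =
        let le′ , eq = partial-stable i≤j le in
        ≤-trans le′ (<⇒≤ (radius-< j)) , trans (partial-old j le′) eq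

      partial-unique : ∀ i j {v} → ℓ v ≤ radius i → ℓ v ≤ radius j → partialColour i v ≡ partialColour j v
      partial-unique i j le le′ with ≤-total i j
      ... | inj₁ i≤j = sym (proj₂ (partial-stable (≤⇒≤′ i≤j) le))
      ... | inj₂ j≤i = proj₂ (partial-stable (≤⇒≤′ j≤i) le′)

      -- Since ℓ v ≤ radius (ℓ v), the colour of `v` is settled by stage ℓ v. Prescribed levels take
      -- precedence; `Breaks` relies on free ones only.
      colour : V → Bool
      colour v = fromMaybe (partialColour (ℓ v) v) (levelColour (ℓ v))

      colour-fits : ∀ v {b} → levelColour (ℓ v) ≡ just b → colour v ≡ b
      colour-fits v eq rewrite eq = refl

      colour-stage : ∀ i {v} → radius i < ℓ v → ℓ v ≤ radius (suc i) →
        levelColour (ℓ v) ≡ nothing → colour v ≡ stageColour i v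
      colour-stage i {v} lt le free rewrite free =
        trans (partial-unique (ℓ v) (suc i) (i≤radius (ℓ v)) le) (partial-new i lt)

      colour-distinguishing : Distinguishing G colour
      colour-distinguishing φ keep v = decidable-stable (Aut.to φ v ≟ⱽ v) λ moved →
        -- As `v` lies within `radius (ℓ v)`, a `φ` moving it is broken in the next annulus.
        let i = ℓ v
            ba = fixed-ballAut φ (Centre.centre-fixed P 3≤P colour colour-fits φ keep) (radius (suc i))
            w , lt , le , level , free , differ =
              proj₂ (proj₂ (proj₂ (stage (radius i)))) _ _ ba (v , i≤radius i , moved)
        in differ (trans
             (sym (colour-stage i (subst (radius i <_) (sym level) lt) (subst (_≤ radius (suc i)) (sym level) le)
               (trans (cong levelColour level) free)))
             (trans (keep w) (colour-stage i lt le free)))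

theorem8 : (G : Graph) → Infinite G → LocallyFinite G → Connected G →
    InfiniteMotion G → (v0 : Graph.V G) → (p q : ℕ) →
    (∀ m → ∃ λ n → n ≥ m × SmallSphere G v0 (suc p) (suc q) n) →
    DistNumber≤2 G
theorem8 G _ lf conn motion v0 p q small = colour , colour-distinguishing
  where
  open Rooted G lf conn v0
  -- With ε = (p + 1) / (q + 1), the ratio of `suc q` to `suc q + suc p` is 1 / (1 + ε).
  Q<T : suc q < suc q + suc p
  Q<T = m<m+n (suc q) z<s
  open Stages motion (suc q) (suc q + suc p) Q<T (≤-trans (s≤s (s≤s z≤n)) Q<T) small
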